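{- For every integer $k\ge 1$, the sequence $(\mathcal{F}(n,k))_{n=k}^\infty$ (the $k$th left-down diagonal of the Fibonacci-Fubini triangle) satisfies the $k$th order homogeneous linear recurrence relation with constant coefficients $$0 = \sum_{j=0}^{k} {k+1 \brack k-j+1}\,\mathcal{F}(n-j,k), \qquad n\geq k+1,$$ where ${\cdot\brack\cdot}$ are the (signed) Stirling numbers of the first kind.
   Context: $F_m$ denotes the Fibonacci numbers: $F_0=0$, $F_1=1$, $F_m=F_{m-1}+F_{m-2}$ for $m\ge 2$. ${n\brace k}$ denotes the Stirling number of the second kind (the number of partitions of an $n$-element set into exactly $k$ non-empty blocks; ${n\brace k}=0$ for $k>n$). The Fibonacci-Fubini triangle has entries $\mathcal{F}(n,k)=F_{k+1}{n\brace k}$, so $\mathcal{F}(n,k)=0$ for $k>n$. The Stirling numbers of the first kind ${n\brack k}$ are signed: ${n\brack n}=1$, ${n\brack 0}=0$ for $n\ge1$, ${n\brack k}=0$ for $k>n$, and ${n \brack k} = {n-1 \brack k-1} - (n-1){n-1 \brack k}$ for $n,k\ge1$; equivalently $x(x-1)\cdots(x-n+1)=\sum_{k=0}^n{n\brack k}x^k$. -}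

module Defs where

open import Data.Bool.Properties using () renaming (_≟_ to _≟ᵇ_)
open import Data.Fin.Subset
  using (Subset; inside; outside; Nonempty; Empty; _∩_; ⋃; ⊤)
open import Data.Fin.Subset.Properties using (nonempty?)
open import Data.Integer.Base as ℤ using (ℤ; 0ℤ; 1ℤ; +_)
open import Data.List.Base using (List; []; _∷_; _++_; map; filter; length)
open import Data.List.Relation.Unary.All as All using (All)
open import Data.List.Relation.Unary.AllPairs using (AllPairs; allPairs?)
open import Data.Nat.Base using (ℕ; zero; suc; _+_; _*_)
open import Data.Product.Base using (_×_)
open import Data.Vec.Base using (_∷_; [])
open import Data.Vec.Properties using (≡-dec)
open import Level using (Level)
open import Relation.Binary.PropositionalEquality.Core using (_≡_)
open import Relation.Nullary.Decidable using (Dec; ¬?; _×-dec_)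

private
  variable
    a : Level
    A : Set a
    n : ℕ

fib : ℕ → ℕ
fib zero          = 0
fib (suc zero)    = 1
fib (suc (suc m)) = fib (suc m) + fib m

-- Every subset of Fin n, each listed exactly once.
subsets : ∀ n → List (Subset n)
subsets zero    = [] ∷ []
subsets (suc n) = map (inside ∷_) (subsets n) ++ map (outside ∷_) (subsets n)

-- The sublists of length k, one for each choice of k positions; for a list
-- without repetitions these are exactly its k-element subsets.
choose : ℕ → List A → List (List A)
choose zero    xs       = [] ∷ []
choose (suc k) []       = []
choose (suc k) (x ∷ xs) = map (x ∷_) (choose k xs) ++ choose (suc k) xs

Disjoint : Subset n → Subset n → Set
Disjoint p q = Empty (p ∩ q)

IsPartition : List (Subset n) → Set
IsPartition bs = All Nonempty bs × AllPairs Disjoint bs × ⋃ bs ≡ ⊤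

isPartition? : (bs : List (Subset n)) → Dec (IsPartition bs)
isPartition? bs =
  All.all? nonempty? bs
    ×-dec allPairs? (λ p q → ¬? (nonempty? (p ∩ q))) bs
    ×-dec ≡-dec _≟ᵇ_ (⋃ bs) ⊤

-- The number of k-element families of subsets of Fin n that partition Fin n.
stirling₂ : ℕ → ℕ → ℕ
stirling₂ n k = length (filter isPartition? (choose k (subsets n)))

-- Signed: x(x-1)⋯(x-n+1) = ∑ₖ (stirling₁ n k) xᵏ.
stirling₁ : ℕ → ℕ → ℤ
stirling₁ zero    zero    = 1ℤ
stirling₁ zero    (suc k) = 0ℤ
stirling₁ (suc n) zero    = 0ℤ
stirling₁ (suc n) (suc k) = stirling₁ n k ℤ.- + n ℤ.* stirling₁ n (suc k)

fibFubini : ℕ → ℕ → ℕ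
fibFubini n k = fib (suc k) * stirling₂ n k

{-# OPTIONS --safe #-}

-- A partition of Fin (n + 1) into k + 1 blocks is determined by the block of
-- zero and the remaining k blocks. Removing zero leaves either a partition into
-- k blocks or a partition into k + 1 blocks with one of them distinguished, so
-- S(n+1,k+1) = S(n,k) + (k+1) S(n,k+1). With E the shift in n, this says that
-- E - (k+1) maps S(·,k+1) to S(·,k), so (E-1)⋯(E-k) maps S(·,k) to S(·,0),
-- which vanishes at positive arguments. The coefficients of
-- (x-1)⋯(x-k) are the Stirling numbers of the first kind.
module Submission where

open import Defs
open import Data.Fin.Base using (toℕ)
open import Data.Integer.Base using (0ℤ; +_; _*_)
open import Data.Integer.Properties using (+-0-commutativeMonoid)
open import Data.Nat.Base using (ℕ; _+_; _∸_; _≤_)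
open import Algebra.Properties.CommutativeMonoid.Sum +-0-commutativeMonoid using (sum⁺-syntax)
open import Relation.Binary.PropositionalEquality using (_≡_)

open import Algebra.Bundles using (module CommutativeMonoid)
open import Algebra.Properties.CommutativeMonoid.Sum +-0-commutativeMonoid
  using (sum-init-last; sum-cong-≗; sum-permute; ∑-distrib-+)
open import Algebra.Properties.Semiring.Sum using (*-distribˡ-sum)
open import Data.Bool.Base using (if_then_else_; true; false)
open import Data.Fin.Base using (Fin; zero; suc; inject₁; fromℕ)
import Data.Fin.Permutation as Perm
import Data.Fin.Properties as Fin
open import Data.Fin.Subset
  using (Subset; inside; outside; Nonempty; Empty; _∪_; ⋃; ⊤)
open import Data.Fin.Subset.Properties
  using ( nonempty?; drop-∷-Empty; Empty-unique; x∈p∩q⁺; x∈p∩q⁻; ∩-comm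
        ; ∪-identityˡ; ∪-commutativeMonoid)
open import Data.Integer.Base as ℤ using (ℤ; 1ℤ)
import Data.Integer.Properties as ℤ
open import Data.Integer.Tactic.RingSolver using (solve-∀)
open import Data.List.Base using (List; []; _∷_; _++_; map; filter; length)
open import Data.List.Properties using (map-cong; map-∘; map-++)
open import Data.List.Relation.Binary.Permutation.Propositional as ↭ using (_↭_)
open import Data.List.Relation.Binary.Permutation.Propositional.Properties using (All-resp-↭)
open import Data.List.Relation.Binary.Permutation.Setoid.Properties
  using (AllPairs-resp-↭; foldr-commMonoid)
open import Data.List.Relation.Unary.All as All using (All; []; _∷_)
import Data.List.Relation.Unary.All.Properties as All
open import Data.List.Relation.Unary.AllPairs as AllPairs using (AllPairs; []; _∷_)
import Data.List.Relation.Unary.AllPairs.Properties as AllPairs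
open import Data.Nat.Base as ℕ using (zero; suc; s≤s)
open import Data.Nat.ListAction using (sum)
open import Data.Nat.ListAction.Properties using (sum-++)
import Data.Nat.Properties as ℕ
open import Data.Product.Base using (_×_; _,_; proj₁)
open import Data.Vec.Base using (here; there) renaming (_∷_ to _∷ᵥ_)
import Data.Vec.Properties as Vec
open import Function.Base using (_∘_; case_of_)
open import Function.Bundles using (_⇔_; mk⇔; module Equivalence)
open import Level using (Level)
open import Relation.Binary.PropositionalEquality
  using (refl; sym; trans; cong; cong₂; subst; setoid; resp₂; module ≡-Reasoning)
open import Relation.Nullary using (¬_; Dec; yes; no; does; ¬?)
open import Relation.Nullary.Decidable using (does-⇔; dec-false)
open import Relation.Unary using (Pred; Decidable)

open ≡-Reasoning

private
  variable
    ℓ₁ ℓ₂ p q : Level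
    A : Set ℓ₁
    B : Set ℓ₂
    P : Set p
    Q : Set q
    n : ℕ

-- Iverson brackets and finite sums over lists.

⟦_⟧ : Dec P → ℕ
⟦ P? ⟧ = if does P? then 1 else 0

⟦⟧-⇔ : P ⇔ Q → (P? : Dec P) (Q? : Dec Q) → ⟦ P? ⟧ ≡ ⟦ Q? ⟧
⟦⟧-⇔ P⇔Q P? Q? = cong (if_then 1 else 0) (does-⇔ P⇔Q P? Q?)

⟦⟧-¬ : (P? : Dec P) → ¬ P → ⟦ P? ⟧ ≡ 0
⟦⟧-¬ P? ¬P = cong (if_then 1 else 0) (dec-false P? ¬P)

sumOver : (A → ℕ) → List A → ℕ
sumOver f xs = sum (map f xs)

sumOver-cong : {f g : A → ℕ} → (∀ x → f x ≡ g x) → ∀ xs → sumOver f xs ≡ sumOver g xs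
sumOver-cong f≗g xs = cong sum (map-cong f≗g xs)

sumOver-++ : (f : A → ℕ) → ∀ xs ys → sumOver f (xs ++ ys) ≡ sumOver f xs + sumOver f ys
sumOver-++ f xs ys = trans (cong sum (map-++ f xs ys)) (sum-++ (map f xs) (map f ys))

sumOver-map : (f : B → ℕ) (g : A → B) → ∀ xs → sumOver f (map g xs) ≡ sumOver (f ∘ g) xs
sumOver-map f g xs = cong sum (sym (map-∘ xs))

sumOver-zero : {f : A → ℕ} → (∀ x → f x ≡ 0) → ∀ xs → sumOver f xs ≡ 0
sumOver-zero f≗0 []       = refl
sumOver-zero f≗0 (x ∷ xs) = cong₂ _+_ (f≗0 x) (sumOver-zero f≗0 xs)

sumOver-+ : (f g : A → ℕ) → ∀ xs → sumOver (λ x → f x + g x) xs ≡ sumOver f xs + sumOver g xs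
sumOver-+ f g []       = refl
sumOver-+ f g (x ∷ xs) = begin
  f x + g x + sumOver (λ y → f y + g y) xs     ≡⟨ cong₂ _+_ refl (sumOver-+ f g xs) ⟩
  f x + g x + (sumOver f xs + sumOver g xs)    ≡⟨ interchange (f x) (g x) _ _ ⟩
  f x + sumOver f xs + (g x + sumOver g xs)    ∎
  where open import Algebra.Properties.CommutativeSemigroup ℕ.+-commutativeSemigroup

sumOver-*ˡ : ∀ c (f : A → ℕ) xs → sumOver (λ x → c ℕ.* f x) xs ≡ c ℕ.* sumOver f xs
sumOver-*ˡ c f []       = sym (ℕ.*-zeroʳ c)
sumOver-*ˡ c f (x ∷ xs) =
  trans (cong₂ _+_ refl (sumOver-*ˡ c f xs)) (sym (ℕ.*-distribˡ-+ c (f x) _))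

sumOver-*ʳ : ∀ c (f : A → ℕ) xs → sumOver (λ x → f x ℕ.* c) xs ≡ sumOver f xs ℕ.* c
sumOver-*ʳ c f []       = refl
sumOver-*ʳ c f (x ∷ xs) =
  trans (cong₂ _+_ refl (sumOver-*ʳ c f xs)) (sym (ℕ.*-distribʳ-+ c (f x) _))

length-filter-sumOver : {R : Pred A p} (R? : Decidable R) →
  ∀ xs → length (filter R? xs) ≡ sumOver (λ x → ⟦ R? x ⟧) xs
length-filter-sumOver R? []       = refl
length-filter-sumOver R? (x ∷ xs) with does (R? x)
... | true  = cong suc (length-filter-sumOver R? xs)
... | false = length-filter-sumOver R? xs

-- Sums over the sublists listed by `choose`.

sumOver-choose-∷ : ∀ k x (xs : List A) f →
  sumOver f (choose (suc k) (x ∷ xs)) ≡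
  sumOver (f ∘ (x ∷_)) (choose k xs) + sumOver f (choose (suc k) xs)
sumOver-choose-∷ k x xs f = trans
  (sumOver-++ f (map (x ∷_) (choose k xs)) _)
  (cong (_+ _) (sumOver-map f (x ∷_) (choose k xs)))

choose-map : ∀ k (g : A → B) xs → choose k (map g xs) ≡ map (map g) (choose k xs)
choose-map zero    g xs       = refl
choose-map (suc k) g []       = refl
choose-map (suc k) g (x ∷ xs) = begin
  map (g x ∷_) (choose k (map g xs)) ++ choose (suc k) (map g xs)
    ≡⟨ cong₂ (λ u v → map (g x ∷_) u ++ v) (choose-map k g xs) (choose-map (suc k) g xs) ⟩
  map (g x ∷_) (map (map g) (choose k xs)) ++ map (map g) (choose (suc k) xs)
    ≡⟨ cong (_++ _) (trans (sym (map-∘ (choose k xs))) (map-∘ (choose k xs))) ⟩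
  map (map g) (map (x ∷_) (choose k xs)) ++ map (map g) (choose (suc k) xs)
    ≡⟨ map-++ (map g) (map (x ∷_) (choose k xs)) _ ⟨
  map (map g) (map (x ∷_) (choose k xs) ++ choose (suc k) xs) ∎

-- Each (k+1)-element sublist arises k + 1 times as an element together with a
-- k-element sublist not containing it.
sumOver-choose-pointed : ∀ k (xs : List A) (f : List A → ℕ) →
  (∀ {ys zs} → ys ↭ zs → f ys ≡ f zs) →
  (∀ x ys → f (x ∷ x ∷ ys) ≡ 0) →
  sumOver (λ x → sumOver (f ∘ (x ∷_)) (choose k xs)) xs ≡ suc k ℕ.* sumOver f (choose (suc k) xs)
sumOver-choose-pointed k [] f f-↭ f-dup = sym (ℕ.*-zeroʳ (suc k))
sumOver-choose-pointed zero (x ∷ xs) f f-↭ f-dup = begin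
  f (x ∷ []) + 0 + sumOver (λ y → sumOver (f ∘ (y ∷_)) (choose 0 xs)) xs
    ≡⟨ cong₂ _+_ (ℕ.+-identityʳ _) (sumOver-choose-pointed 0 xs f f-↭ f-dup) ⟩
  f (x ∷ []) + 1 ℕ.* sumOver f (choose 1 xs)
    ≡⟨ cong (λ v → f (x ∷ []) + v) (ℕ.*-identityˡ (sumOver f (choose 1 xs))) ⟩
  sumOver f (choose 1 (x ∷ xs))
    ≡⟨ ℕ.*-identityˡ (sumOver f (choose 1 (x ∷ xs))) ⟨
  1 ℕ.* sumOver f (choose 1 (x ∷ xs)) ∎
sumOver-choose-pointed (suc k) (x ∷ xs) f f-↭ f-dup = begin
  sumOver (f ∘ (x ∷_)) (choose (suc k) (x ∷ xs)) +
  sumOver (λ y → sumOver (f ∘ (y ∷_)) (choose (suc k) (x ∷ xs))) xs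
    ≡⟨ cong₂ _+_ pointed-at-x pointed-elsewhere ⟩
  u + (suc k ℕ.* u + suc (suc k) ℕ.* v)
    ≡⟨ ℕ.+-assoc u _ _ ⟨
  suc (suc k) ℕ.* u + suc (suc k) ℕ.* v
    ≡⟨ ℕ.*-distribˡ-+ (suc (suc k)) u v ⟨
  suc (suc k) ℕ.* (u + v)
    ≡⟨ cong (suc (suc k) ℕ.*_) (sumOver-choose-∷ (suc k) x xs f) ⟨
  suc (suc k) ℕ.* sumOver f (choose (suc (suc k)) (x ∷ xs)) ∎
  where
  -- `u` collects the sublists of length `suc (suc k)` that use the leading `x`, `v` those that do
  -- not.
  u = sumOver (f ∘ (x ∷_)) (choose (suc k) xs)
  v = sumOver f (choose (suc (suc k)) xs)

  pointed-at-x : sumOver (f ∘ (x ∷_)) (choose (suc k) (x ∷ xs)) ≡ u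
  -- With `x` distinguished, a sublist that uses `x` again repeats it, and `f-dup` kills the term.
  pointed-at-x = trans (sumOver-choose-∷ k x xs (f ∘ (x ∷_)))
    (cong (_+ u) (sumOver-zero (f-dup x) (choose k xs)))

  -- Makes the induction hypothesis applicable to `f ∘ (x ∷_)`: two swaps carry `x` past the
  -- repeated pair.
  f∘x∷-dup : ∀ y ys → f (x ∷ y ∷ y ∷ ys) ≡ 0
  f∘x∷-dup y ys = trans
    (f-↭ (↭.trans (↭.swap x y ↭.refl) (↭.prep y (↭.swap x y ↭.refl)))) (f-dup y (x ∷ ys))

  pointed-elsewhere :
    sumOver (λ y → sumOver (f ∘ (y ∷_)) (choose (suc k) (x ∷ xs))) xs ≡
    suc k ℕ.* u + suc (suc k) ℕ.* v
  pointed-elsewhere = begin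
    sumOver (λ y → sumOver (f ∘ (y ∷_)) (choose (suc k) (x ∷ xs))) xs
      -- Split on whether the sublist uses `x`; if it does, move `x` in front of the distinguished
      -- `y`, so that `x` is a fixed head and `y` is distinguished among the rest.
      ≡⟨ sumOver-cong (λ y → trans (sumOver-choose-∷ k x xs (f ∘ (y ∷_)))
           (cong (_+ _) (sumOver-cong (λ ys → f-↭ (↭.swap y x ↭.refl)) (choose k xs)))) xs ⟩
    sumOver (λ y → sumOver (f ∘ (x ∷_) ∘ (y ∷_)) (choose k xs) +
                   sumOver (f ∘ (y ∷_)) (choose (suc k) xs)) xs
      ≡⟨ sumOver-+ _ _ xs ⟩
    sumOver (λ y → sumOver (f ∘ (x ∷_) ∘ (y ∷_)) (choose k xs)) xs +
    sumOver (λ y → sumOver (f ∘ (y ∷_)) (choose (suc k) xs)) xs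
      ≡⟨ cong₂ _+_
           (sumOver-choose-pointed k xs (f ∘ (x ∷_)) (f-↭ ∘ ↭.prep x) f∘x∷-dup)
           (sumOver-choose-pointed (suc k) xs f f-↭ f-dup) ⟩
    suc k ℕ.* u + suc (suc k) ℕ.* v ∎

-- Sublists keep the order of the list, so one that uses any entry of `map g xs` has such an entry
-- as its head, and `f` vanishes there.
sumOver-choose-none : ∀ k (g : A → B) xs ys f → (∀ x zs → f (g x ∷ zs) ≡ 0) →
  sumOver f (choose k (map g xs ++ ys)) ≡ sumOver f (choose k ys)
sumOver-choose-none zero    g xs       ys f f-g = refl
sumOver-choose-none (suc k) g []       ys f f-g = refl
sumOver-choose-none (suc k) g (x ∷ xs) ys f f-g = trans
  (sumOver-choose-∷ k (g x) (map g xs ++ ys) f)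
  (cong₂ _+_ (sumOver-zero (f-g x) (choose k (map g xs ++ ys)))
             (sumOver-choose-none (suc k) g xs ys f f-g))

-- Two or more entries from `map g xs` would be the leading ones and make `f` vanish; the sublists
-- with no such entry sum to zero by hypothesis. What is left uses exactly one, as its head.
sumOver-choose-one : ∀ k (g : A → B) xs ys f → (∀ x x′ zs → f (g x ∷ g x′ ∷ zs) ≡ 0) →
  sumOver f (choose (suc k) ys) ≡ 0 →
  sumOver f (choose (suc k) (map g xs ++ ys)) ≡
  sumOver (λ x → sumOver (f ∘ (g x ∷_)) (choose k ys)) xs
sumOver-choose-one k g []       ys f f-gg f-ys = f-ys
sumOver-choose-one k g (x ∷ xs) ys f f-gg f-ys = trans
  (sumOver-choose-∷ k (g x) (map g xs ++ ys) f)
  (cong₂ _+_ (sumOver-choose-none k g xs ys (f ∘ (g x ∷_)) (f-gg x))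
             (sumOver-choose-one k g xs ys f f-gg f-ys))

-- Partitions of `Fin (suc n)` and the block of zero.

outside-Empty : {s : Subset n} → Empty s → Empty (outside ∷ᵥ s)
outside-Empty e (suc x , there x∈s) = e (x , x∈s)

-- Ensures that the partitions in which zero is a singleton block are counted once. A subset with
-- head `inside` contains zero, so each level only passes on the count of its tail.
sumOver-subsets-empty : ∀ n → sumOver (λ s → ⟦ ¬? (nonempty? s) ⟧) (subsets n) ≡ 1
sumOver-subsets-empty zero    = refl
sumOver-subsets-empty (suc n) = begin
  sumOver ε (map (inside ∷ᵥ_) (subsets n) ++ map (outside ∷ᵥ_) (subsets n))
    ≡⟨ sumOver-++ ε (map (inside ∷ᵥ_) (subsets n)) _ ⟩
  sumOver ε (map (inside ∷ᵥ_) (subsets n)) + sumOver ε (map (outside ∷ᵥ_) (subsets n))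
    ≡⟨ cong₂ _+_ (sumOver-map ε _ (subsets n)) (sumOver-map ε _ (subsets n)) ⟩
  sumOver (λ s → ε (inside ∷ᵥ s)) (subsets n) + sumOver (λ s → ε (outside ∷ᵥ s)) (subsets n)
    ≡⟨ cong₂ _+_
         (sumOver-zero (λ s → ⟦⟧-¬ (¬? (nonempty? (inside ∷ᵥ s))) (λ e → e (zero , here))) (subsets n))
         (sumOver-cong (λ s → ⟦⟧-⇔ (mk⇔ drop-∷-Empty outside-Empty) (¬? (nonempty? _)) (¬? (nonempty? s)))
           (subsets n)) ⟩
  sumOver (λ s → ⟦ ¬? (nonempty? s) ⟧) (subsets n)
    ≡⟨ sumOver-subsets-empty n ⟩
  1 ∎
  where
  ε : Subset (suc n) → ℕ
  ε s = ⟦ ¬? (nonempty? s) ⟧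

⋃-↭ : {ss ts : List (Subset n)} → ss ↭ ts → ⋃ ss ≡ ⋃ ts
⋃-↭ {n} ss↭ts = foldr-commMonoid ∪.setoid ∪.isCommutativeMonoid (↭.↭⇒↭ₛ ss↭ts)
  where module ∪ = CommutativeMonoid (∪-commutativeMonoid n)

-- Distinguishing a block brings it to the front of the list, so the count must be insensitive to
-- the order of the blocks.
IsPartition-↭ : {ss ts : List (Subset n)} → ss ↭ ts → IsPartition ss → IsPartition ts
IsPartition-↭ ss↭ts (nonempty , disjoint , cover) =
  All-resp-↭ ss↭ts nonempty ,
  AllPairs-resp-↭ (setoid _)
    (λ {s} {t} → subst Empty (∩-comm s t)) (resp₂ Disjoint) (↭.↭⇒↭ₛ ss↭ts) disjoint ,
  trans (⋃-↭ (↭.↭-sym ss↭ts)) cover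

⟦partition⟧ : List (Subset n) → ℕ
⟦partition⟧ ss = ⟦ isPartition? ss ⟧

⟦partition⟧-↭ : {ss ts : List (Subset n)} → ss ↭ ts → ⟦partition⟧ ss ≡ ⟦partition⟧ ts
⟦partition⟧-↭ ss↭ts =
  ⟦⟧-⇔ (mk⇔ (IsPartition-↭ ss↭ts) (IsPartition-↭ (↭.↭-sym ss↭ts))) (isPartition? _) (isPartition? _)

-- A nonempty block meets itself. This is the condition `f-dup` of `sumOver-choose-pointed`.
⟦partition⟧-dup : (s : Subset n) (ss : List (Subset n)) → ⟦partition⟧ (s ∷ s ∷ ss) ≡ 0
⟦partition⟧-dup s ss = ⟦⟧-¬ (isPartition? (s ∷ s ∷ ss))
  λ { ((x , x∈s) ∷ _ , (disjoint ∷ _) ∷ _ , _) → disjoint (x , x∈p∩q⁺ (x∈s , x∈s)) }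

-- The two leading blocks meet at zero.
⟦partition⟧-inside-inside : (s t : Subset n) (ss : List (Subset (suc n))) →
  ⟦partition⟧ ((inside ∷ᵥ s) ∷ (inside ∷ᵥ t) ∷ ss) ≡ 0
⟦partition⟧-inside-inside s t ss = ⟦⟧-¬ (isPartition? ((inside ∷ᵥ s) ∷ (inside ∷ᵥ t) ∷ ss))
  λ { (_ , (disjoint ∷ _) ∷ _ , _) → disjoint (zero , here) }

⋃-outside : (ss : List (Subset n)) → ⋃ (map (outside ∷ᵥ_) ss) ≡ outside ∷ᵥ ⋃ ss
⋃-outside []       = refl
⋃-outside (s ∷ ss) = cong ((outside ∷ᵥ s) ∪_) (⋃-outside ss)

-- Zero is left uncovered. The case of an empty `ss` gives `stirling₂-suc-zero`.
⟦partition⟧-outside : (ss : List (Subset n)) → ⟦partition⟧ (map (outside ∷ᵥ_) ss) ≡ 0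
⟦partition⟧-outside ss = ⟦⟧-¬ (isPartition? (map (outside ∷ᵥ_) ss))
  λ { (_ , _ , cover) → case trans (sym (⋃-outside ss)) cover of λ () }

-- Zero itself witnesses that its block is nonempty, so the right side leaves open whether `s` is
-- empty. `⟦partition⟧-inside` splits on exactly this.
IsPartition-inside : (s : Subset n) (ss : List (Subset n)) →
  IsPartition ((inside ∷ᵥ s) ∷ map (outside ∷ᵥ_) ss) ⇔
  (All Nonempty ss × AllPairs Disjoint (s ∷ ss) × ⋃ (s ∷ ss) ≡ ⊤)
IsPartition-inside s ss = mk⇔
  (λ { (_ ∷ nonempty , s# ∷ disjoint , cover) →
    All.map drop-outside (All.map⁻ nonempty) ,
    (All.map drop-∷-Empty (All.map⁻ s#) ∷ AllPairs.map drop-∷-Empty (AllPairs.map⁻ disjoint)) ,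
    Vec.∷-injectiveʳ (trans (sym cover-∷) cover) })
  (λ { (nonempty , s# ∷ disjoint , cover) →
    ((zero , here) ∷ All.map⁺ (All.map (λ { (x , x∈t) → suc x , there x∈t }) nonempty)) ,
    (All.map⁺ (All.map outside-Empty s#) ∷ AllPairs.map⁺ (AllPairs.map outside-Empty disjoint)) ,
    trans cover-∷ (cong (inside ∷ᵥ_) cover) })
  where
  drop-outside : {t : Subset n} → Nonempty (outside ∷ᵥ t) → Nonempty t
  drop-outside (suc x , there x∈t) = x , x∈t

  cover-∷ : ⋃ ((inside ∷ᵥ s) ∷ map (outside ∷ᵥ_) ss) ≡ inside ∷ᵥ ⋃ (s ∷ ss)
  cover-∷ = cong ((inside ∷ᵥ s) ∪_) (⋃-outside ss)

-- s is the block of zero with zero removed.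
⟦partition⟧-inside : (s : Subset n) (ss : List (Subset n)) →
  ⟦partition⟧ ((inside ∷ᵥ s) ∷ map (outside ∷ᵥ_) ss) ≡
  ⟦ ¬? (nonempty? s) ⟧ ℕ.* ⟦partition⟧ ss + ⟦partition⟧ (s ∷ ss)
⟦partition⟧-inside {n} s ss = split (nonempty? s)
  where
  partition₀? = isPartition? ((inside ∷ᵥ s) ∷ map (outside ∷ᵥ_) ss)
  open Equivalence (IsPartition-inside s ss)

  split : (s? : Dec (Nonempty s)) →
    ⟦ partition₀? ⟧ ≡ ⟦ ¬? s? ⟧ ℕ.* ⟦partition⟧ ss + ⟦partition⟧ (s ∷ ss)
  -- A nonempty `s` is a block in its own right, and the first summand has weight 0.
  split (yes s≢⊥) = ⟦⟧-⇔
    (mk⇔ (λ π → case to π of λ { (nonempty , rest) → s≢⊥ ∷ nonempty , rest })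
         (λ { (_ ∷ nonempty , rest) → from (nonempty , rest) }))
    partition₀? (isPartition? (s ∷ ss))
  -- Here zero is a singleton block: the other blocks must already cover, and `s ∷ ss` is no
  -- partition because `s` is empty.
  split (no s≡⊥) = begin
    ⟦ partition₀? ⟧
      ≡⟨ ⟦⟧-⇔ (mk⇔
           (λ π → case to π of λ { (nonempty , _ ∷ disjoint , cover) →
             nonempty , disjoint , trans (sym ⋃-s) cover })
           (λ { (nonempty , disjoint , cover) → from
             (nonempty , All.universal s# ss ∷ disjoint , trans ⋃-s cover) }))
           partition₀? (isPartition? ss) ⟩
    ⟦partition⟧ ss
      ≡⟨ ℕ.*-identityˡ _ ⟨
    1 ℕ.* ⟦partition⟧ ss
      ≡⟨ ℕ.+-identityʳ _ ⟨
    1 ℕ.* ⟦partition⟧ ss + 0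
      ≡⟨ cong (λ v → 1 ℕ.* ⟦partition⟧ ss + v)
           (⟦⟧-¬ (isPartition? (s ∷ ss)) (λ { (s≢⊥ ∷ _ , _) → s≡⊥ s≢⊥ })) ⟨
    1 ℕ.* ⟦partition⟧ ss + ⟦partition⟧ (s ∷ ss) ∎
    where
    ⋃-s : ⋃ (s ∷ ss) ≡ ⋃ ss
    ⋃-s = trans (cong (_∪ ⋃ ss) (Empty-unique s≡⊥)) (∪-identityˡ (⋃ ss))

    s# : (t : Subset n) → Disjoint s t
    s# t (x , x∈s∩t) = s≡⊥ (x , proj₁ (x∈p∩q⁻ s t x∈s∩t))

-- The recurrence for Stirling numbers of the second kind.

stirling₂-sumOver : ∀ n k → stirling₂ n k ≡ sumOver ⟦partition⟧ (choose k (subsets n))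
stirling₂-sumOver n k = length-filter-sumOver isPartition? (choose k (subsets n))

stirling₂-suc-zero : ∀ n → stirling₂ (suc n) 0 ≡ 0
stirling₂-suc-zero n = trans (stirling₂-sumOver (suc n) 0) (cong (_+ 0) (⟦partition⟧-outside {n} []))

stirling₂-suc-suc : ∀ n k →
  stirling₂ (suc n) (suc k) ≡ stirling₂ n k + suc k ℕ.* stirling₂ n (suc k)
stirling₂-suc-suc n k = begin
  stirling₂ (suc n) (suc k)
    ≡⟨ stirling₂-sumOver (suc n) (suc k) ⟩
  sumOver ⟦partition⟧ (choose (suc k) (map (inside ∷ᵥ_) S ++ map (outside ∷ᵥ_) S))
    -- `subsets (suc n)` lists the sets containing zero first, and exactly one block of a partition
    -- is among them.
    ≡⟨ sumOver-choose-one k (inside ∷ᵥ_) S (map (outside ∷ᵥ_) S) ⟦partition⟧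
         ⟦partition⟧-inside-inside
         (trans (sumOver-outside (suc k) ⟦partition⟧)
                (sumOver-zero ⟦partition⟧-outside (choose (suc k) S))) ⟩
  sumOver (λ s → sumOver (⟦partition⟧ ∘ ((inside ∷ᵥ s) ∷_)) (choose k (map (outside ∷ᵥ_) S))) S
    ≡⟨ sumOver-cong (λ s → sumOver-outside k (⟦partition⟧ ∘ ((inside ∷ᵥ s) ∷_))) S ⟩
  sumOver (λ s → sumOver (λ ss → ⟦partition⟧ ((inside ∷ᵥ s) ∷ map (outside ∷ᵥ_) ss)) (choose k S)) S
    ≡⟨ sumOver-cong (λ s → begin
         sumOver (λ ss → ⟦partition⟧ ((inside ∷ᵥ s) ∷ map (outside ∷ᵥ_) ss)) (choose k S)
           ≡⟨ sumOver-cong (⟦partition⟧-inside s) (choose k S) ⟩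
         sumOver (λ ss → ε s ℕ.* ⟦partition⟧ ss + ⟦partition⟧ (s ∷ ss)) (choose k S)
           ≡⟨ sumOver-+ _ _ (choose k S) ⟩
         sumOver (λ ss → ε s ℕ.* ⟦partition⟧ ss) (choose k S) +
         sumOver (⟦partition⟧ ∘ (s ∷_)) (choose k S)
           ≡⟨ cong (_+ sumOver (⟦partition⟧ ∘ (s ∷_)) (choose k S)) (sumOver-*ˡ (ε s) ⟦partition⟧ (choose k S)) ⟩
         ε s ℕ.* σ k + sumOver (⟦partition⟧ ∘ (s ∷_)) (choose k S) ∎) S ⟩
  sumOver (λ s → ε s ℕ.* σ k + sumOver (⟦partition⟧ ∘ (s ∷_)) (choose k S)) S
    ≡⟨ sumOver-+ _ _ S ⟩
  sumOver (λ s → ε s ℕ.* σ k) S + sumOver (λ s → sumOver (⟦partition⟧ ∘ (s ∷_)) (choose k S)) S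
    -- Only one `s` has `ε s` equal to 1, which gives `σ k`. In the other sum `s` is a distinguished
    -- block of a partition into `suc k` blocks, whence the factor `suc k`.
    ≡⟨ cong₂ _+_
         (trans (sumOver-*ʳ (σ k) ε S)
           (trans (cong (ℕ._* σ k) (sumOver-subsets-empty n)) (ℕ.*-identityˡ (σ k))))
         (sumOver-choose-pointed k S ⟦partition⟧ ⟦partition⟧-↭ ⟦partition⟧-dup) ⟩
  σ k + suc k ℕ.* σ (suc k)
    ≡⟨ cong₂ (λ u v → u + suc k ℕ.* v) (stirling₂-sumOver n k) (stirling₂-sumOver n (suc k)) ⟨
  stirling₂ n k + suc k ℕ.* stirling₂ n (suc k) ∎
  where
  S = subsets n

  σ : ℕ → ℕ
  σ j = sumOver ⟦partition⟧ (choose j S)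

  ε : Subset n → ℕ
  ε s = ⟦ ¬? (nonempty? s) ⟧

  sumOver-outside : ∀ j (f : List (Subset (suc n)) → ℕ) →
    sumOver f (choose j (map (outside ∷ᵥ_) S)) ≡ sumOver (f ∘ map (outside ∷ᵥ_)) (choose j S)
  sumOver-outside j f = trans (cong (sumOver f) (choose-map j (outside ∷ᵥ_) S))
                              (sumOver-map f (map (outside ∷ᵥ_)) (choose j S))

-- Stirling numbers of the first kind as coefficients of a shift operator.

stirling₁-< : ∀ {n k} → n ℕ.< k → stirling₁ n k ≡ 0ℤ
stirling₁-< {zero}  {suc k} _         = refl
stirling₁-< {suc n} {suc k} (s≤s n<k) = begin
  stirling₁ n k ℤ.- + n * stirling₁ n (suc k)
    ≡⟨ cong₂ (λ u v → u ℤ.- + n * v) (stirling₁-< n<k) (stirling₁-< (ℕ.m<n⇒m<1+n n<k)) ⟩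
  0ℤ ℤ.- + n * 0ℤ
    ≡⟨ cong (λ u → 0ℤ ℤ.- u) (ℤ.*-zeroʳ (+ n)) ⟩
  0ℤ ∎

-- The left side of stirling₁-sum-suc is ((E-1)⋯(E-(k+1)) a)(0), the right side
-- ((E-1)⋯(E-k) b)(0) with b = (E-(k+1)) a.
stirling₁-sum-suc : ∀ k (a : ℕ → ℤ) →
  ∑[ i ≤ suc k ] (stirling₁ (suc (suc k)) (suc (toℕ i)) * a (toℕ i)) ≡
  ∑[ i ≤ k ] (stirling₁ (suc k) (suc (toℕ i)) * (a (suc (toℕ i)) ℤ.- + suc k * a (toℕ i)))
stirling₁-sum-suc k a = begin
  ∑[ i ≤ suc k ] ((c (toℕ i) ℤ.- + suc k * c (suc (toℕ i))) * a (toℕ i))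
    ≡⟨ sum-cong-≗ {suc (suc k)} (λ i → expand (c (toℕ i)) (+ suc k) (c (suc (toℕ i))) (a (toℕ i))) ⟩
  ∑[ i ≤ suc k ] (c (toℕ i) * a (toℕ i) ℤ.+ d (toℕ i))
    ≡⟨ ∑-distrib-+ {suc (suc k)} (λ i → c (toℕ i) * a (toℕ i)) (λ i → d (toℕ i)) ⟩
  ∑[ i ≤ suc k ] (c (toℕ i) * a (toℕ i)) ℤ.+ ∑[ i ≤ suc k ] d (toℕ i)
    -- The first sum loses its initial term because `c 0` computes to `0ℤ`; the second loses its
    -- final term, whose coefficient `c (suc (suc k))` lies beyond the diagonal.
    ≡⟨ cong₂ ℤ._+_ (ℤ.+-identityˡ (∑[ i ≤ k ] (c (suc (toℕ i)) * a (suc (toℕ i))))) drop-last ⟩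
  ∑[ i ≤ k ] (c (suc (toℕ i)) * a (suc (toℕ i))) ℤ.+ ∑[ i ≤ k ] d (toℕ i)
    ≡⟨ ∑-distrib-+ {suc k} (λ i → c (suc (toℕ i)) * a (suc (toℕ i))) (λ i → d (toℕ i)) ⟨
  ∑[ i ≤ k ] (c (suc (toℕ i)) * a (suc (toℕ i)) ℤ.+ d (toℕ i))
    ≡⟨ sum-cong-≗ {suc k} (λ i →
         collect (c (suc (toℕ i))) (a (suc (toℕ i))) (+ suc k) (a (toℕ i))) ⟩
  ∑[ i ≤ k ] (c (suc (toℕ i)) * (a (suc (toℕ i)) ℤ.- + suc k * a (toℕ i))) ∎
  where
  c d : ℕ → ℤ
  c i = stirling₁ (suc k) i
  d i = ℤ.- (+ suc k * (c (suc i) * a i))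

  expand : ∀ u v w x → (u ℤ.- v * w) * x ≡ u * x ℤ.+ ℤ.- (v * (w * x))
  expand = solve-∀

  collect : ∀ u v w x → u * v ℤ.+ ℤ.- (w * (u * x)) ≡ u * (v ℤ.- w * x)
  collect = solve-∀

  d-last : d (suc k) ≡ 0ℤ
  d-last = begin
    ℤ.- (+ suc k * (c (suc (suc k)) * a (suc k)))
      ≡⟨ cong (λ u → ℤ.- (+ suc k * (u * a (suc k)))) (stirling₁-< (ℕ.n<1+n (suc k))) ⟩
    ℤ.- (+ suc k * 0ℤ)
      ≡⟨ cong ℤ.-_ (ℤ.*-zeroʳ (+ suc k)) ⟩
    0ℤ ∎

  drop-last : ∑[ i ≤ suc k ] d (toℕ i) ≡ ∑[ i ≤ k ] d (toℕ i)
  drop-last = begin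
    ∑[ i ≤ suc k ] d (toℕ i)
      ≡⟨ sum-init-last {suc k} (λ i → d (toℕ i)) ⟩
    ∑[ i ≤ k ] d (toℕ (inject₁ i)) ℤ.+ d (toℕ (fromℕ (suc k)))
      ≡⟨ cong₂ ℤ._+_ (sum-cong-≗ {suc k} (λ i → cong d (Fin.toℕ-inject₁ i)))
                     (trans (cong d (Fin.toℕ-fromℕ (suc k))) d-last) ⟩
    ∑[ i ≤ k ] d (toℕ i) ℤ.+ 0ℤ
      ≡⟨ ℤ.+-identityʳ _ ⟩
    ∑[ i ≤ k ] d (toℕ i) ∎

-- Induction on `k`, peeling off the factor `E - (k+1)` each time. The coefficient at `i` is that of
-- the `i`th power of `E`. Starting at `suc m` keeps the argument positive, so that the base case
-- `S(·,0)` vanishes.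
stirling-recurrence : ∀ k m →
  ∑[ i ≤ k ] (stirling₁ (suc k) (suc (toℕ i)) * + stirling₂ (suc m + toℕ i) k) ≡ 0ℤ
stirling-recurrence zero m = begin
  1ℤ * + stirling₂ (suc m + 0) 0 ℤ.+ 0ℤ
    ≡⟨ cong (λ u → 1ℤ * + u ℤ.+ 0ℤ) (stirling₂-suc-zero (m + 0)) ⟩
  0ℤ ∎
stirling-recurrence (suc k) m = begin
  ∑[ i ≤ suc k ] (stirling₁ (suc (suc k)) (suc (toℕ i)) * a (toℕ i))
    ≡⟨ stirling₁-sum-suc k a ⟩
  ∑[ i ≤ k ] (stirling₁ (suc k) (suc (toℕ i)) * (a (suc (toℕ i)) ℤ.- + suc k * a (toℕ i)))
    ≡⟨ sum-cong-≗ {suc k} (λ i → cong (stirling₁ (suc k) (suc (toℕ i)) *_) (a-step (toℕ i))) ⟩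
  ∑[ i ≤ k ] (stirling₁ (suc k) (suc (toℕ i)) * + stirling₂ (suc m + toℕ i) k)
    ≡⟨ stirling-recurrence k m ⟩
  0ℤ ∎
  where
  a : ℕ → ℤ
  a i = + stirling₂ (suc m + i) (suc k)

  cancel : ∀ u v → u ℤ.+ v ℤ.- v ≡ u
  cancel = solve-∀

  -- The recurrence `stirling₂-suc-suc`, solved for its first summand.
  a-step : ∀ i → a (suc i) ℤ.- + suc k * a i ≡ + stirling₂ (suc m + i) k
  a-step i = begin
    + stirling₂ (suc m + suc i) (suc k) ℤ.- + suc k * a i
      ≡⟨ cong (λ j → + stirling₂ j (suc k) ℤ.- + suc k * a i) (ℕ.+-suc (suc m) i) ⟩
    + stirling₂ (suc (suc m + i)) (suc k) ℤ.- + suc k * a i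
      ≡⟨ cong₂ (λ u v → + u ℤ.- v) (stirling₂-suc-suc (suc m + i) k)
           (sym (ℤ.pos-* (suc k) (stirling₂ (suc m + i) (suc k)))) ⟩
    + (stirling₂ (suc m + i) k + suc k ℕ.* stirling₂ (suc m + i) (suc k)) ℤ.-
    + (suc k ℕ.* stirling₂ (suc m + i) (suc k))
      ≡⟨ cancel (+ stirling₂ (suc m + i) k) (+ (suc k ℕ.* stirling₂ (suc m + i) (suc k))) ⟩
    + stirling₂ (suc m + i) k ∎

-- Transfer to the Fibonacci-Fubini numbers.

fibFubini-recurrence : ∀ k m →
  ∑[ j ≤ k ] (stirling₁ (suc k) (suc (k ∸ toℕ j)) * + fibFubini (suc m + k ∸ toℕ j) k) ≡ 0ℤ
fibFubini-recurrence k m = begin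
  ∑[ j ≤ k ] f (toℕ j)
    -- The index `j` counts down from the top power of `E`; reversal turns it into the exponent
    -- `i = k - j`.
    ≡⟨ sum-permute {suc k} {suc k} (λ j → f (toℕ j)) Perm.reverse ⟩
  ∑[ i ≤ k ] f (toℕ (Perm.reverse Perm.⟨$⟩ʳ i))
    ≡⟨ sum-cong-≗ {suc k} f-reverse ⟩
  ∑[ i ≤ k ] (+ fib (suc k) * g (toℕ i))
    -- Along a diagonal `k` is fixed, so the Fibonacci factor is common to all terms.
    ≡⟨ *-distribˡ-sum ℤ.+-*-semiring {suc k} (+ fib (suc k)) (λ i → g (toℕ i)) ⟨
  + fib (suc k) * ∑[ i ≤ k ] g (toℕ i)
    ≡⟨ cong (+ fib (suc k) *_) (stirling-recurrence k m) ⟩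
  + fib (suc k) * 0ℤ
    ≡⟨ ℤ.*-zeroʳ (+ fib (suc k)) ⟩
  0ℤ ∎
  where
  f g : ℕ → ℤ
  f j = stirling₁ (suc k) (suc (k ∸ j)) * + fibFubini (suc m + k ∸ j) k
  g i = stirling₁ (suc k) (suc i) * + stirling₂ (suc m + i) k

  pull : ∀ u v w → u * (v * w) ≡ v * (u * w)
  pull = solve-∀

  f-reverse : (i : Fin (suc k)) → f (toℕ (Perm.reverse Perm.⟨$⟩ʳ i)) ≡ + fib (suc k) * g (toℕ i)
  f-reverse i = begin
    f (toℕ (Perm.reverse Perm.⟨$⟩ʳ i))
      ≡⟨ cong f (Fin.opposite-prop i) ⟩
    stirling₁ (suc k) (suc (k ∸ (k ∸ toℕ i))) * + fibFubini (suc m + k ∸ (k ∸ toℕ i)) k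
      -- Since `toℕ i` is at most `k`, none of these subtractions truncates and the double
      -- complement cancels.
      ≡⟨ cong (λ l → stirling₁ (suc k) (suc (k ∸ (k ∸ toℕ i))) * + fibFubini l k)
           (ℕ.+-∸-assoc (suc m) (ℕ.m∸n≤m k (toℕ i))) ⟩
    stirling₁ (suc k) (suc (k ∸ (k ∸ toℕ i))) * + fibFubini (suc m + (k ∸ (k ∸ toℕ i))) k
      ≡⟨ cong (λ l → stirling₁ (suc k) (suc l) * + fibFubini (suc m + l) k)
           (ℕ.m∸[m∸n]≡n (Fin.toℕ≤pred[n] i)) ⟩
    stirling₁ (suc k) (suc (toℕ i)) * + fibFubini (suc m + toℕ i) k
      ≡⟨ cong (stirling₁ (suc k) (suc (toℕ i)) *_) (ℤ.pos-* (fib (suc k)) (stirling₂ (suc m + toℕ i) k)) ⟩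
    stirling₁ (suc k) (suc (toℕ i)) * (+ fib (suc k) * + stirling₂ (suc m + toℕ i) k)
      ≡⟨ pull (stirling₁ (suc k) (suc (toℕ i))) (+ fib (suc k)) (+ stirling₂ (suc m + toℕ i) k) ⟩
    + fib (suc k) * g (toℕ i) ∎

theorem10 : ∀ (k : ℕ) → 1 ≤ k → ∀ (n : ℕ) → k + 1 ≤ n →
    0ℤ ≡ ∑[ j ≤ k ] (stirling₁ (k + 1) (k ∸ toℕ j + 1) * + fibFubini (n ∸ toℕ j) k)
theorem10 k 1≤k n k+1≤n = begin
  0ℤ
    ≡⟨ fibFubini-recurrence k m ⟨
  ∑[ j ≤ k ] (stirling₁ (suc k) (suc (k ∸ toℕ j)) * + fibFubini (suc m + k ∸ toℕ j) k)
    ≡⟨ sum-cong-≗ {suc k} (λ j → cong₂ _*_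
         (cong₂ stirling₁ (ℕ.+-comm 1 k) (ℕ.+-comm 1 (k ∸ toℕ j)))
         (cong (λ l → + fibFubini (l ∸ toℕ j) k) suc-m+k≡n)) ⟩
  ∑[ j ≤ k ] (stirling₁ (k + 1) (k ∸ toℕ j + 1) * + fibFubini (n ∸ toℕ j) k) ∎
  where
  -- The excess of `n` over the least admissible index `k + 1`.
  m = n ∸ (k + 1)

  suc-m+k≡n : suc m + k ≡ n
  suc-m+k≡n = begin
    suc (m + k)   ≡⟨ ℕ.+-suc m k ⟨
    m + suc k     ≡⟨ cong (λ l → m + l) (ℕ.+-comm 1 k) ⟩
    m + (k + 1)   ≡⟨ ℕ.m∸n+n≡m k+1≤n ⟩
    n             ∎
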